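{- For every integer $n\ge 3$, the cocktail party graph $CP(n)$ satisfies $\operatorname{st}_{\gamma_{st}}(CP(n))=1$.
   Context: All graphs are finite, simple and undirected. For a graph $G=(V,E)$, a set $D\subseteq V$ is a strong dominating set if every vertex $v\in V\setminus D$ is adjacent to some $u\in D$ with $\deg(v)\le\deg(u)$ (degrees taken in $G$). The strong domination number $\gamma_{st}(G)$ is the minimum size of a strong dominating set. For $S\subseteq V$, $G-S$ is the graph obtained by deleting the vertices of $S$. The stability of the strong domination number is $\operatorname{st}_{\gamma_{st}}(G)=\min\{|S| : S\subseteq V,\ \gamma_{st}(G-S)\ne\gamma_{st}(G)\}$. The cocktail party graph $CP(n)$ is the complete $n$-partite graph with each part of size $2$; equivalently, $K_{2n}$ minus a perfect matching. -}

module Defs where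

open import Data.Empty using (⊥-elim)
open import Data.Fin.Base using (Fin; zero; quotient)
open import Data.Fin.Properties using (all?; any?; _≟_)
open import Data.Fin.Subset using (Subset; _∈_; _∉_; _⊆_; _─_; ∣_∣; ⊤; ⊥; Nonempty; inside; outside)
open import Data.Fin.Subset.Properties
  using (_∈?_; _⊆?_; anySubset?; ∣⊥∣≡0; ∈⊤; ∣⁅x⁆∣≡1; x∈⁅y⁆⇒x≡y; p⊆q⇒∣p∣≤∣q∣)
open import Data.Nat.Base using (ℕ; _*_; _≤_; _<_; s≤s)
open import Data.Nat.Induction using (Acc; acc; <-wellFounded)
open import Data.Nat.Properties using (_≤?_; _<?_; ≮⇒≥; n≤0⇒n≡0; n≮0) renaming (_≟_ to _≟ℕ_)
open import Data.Product.Base using (∃; ∃-syntax; _×_; _,_; proj₁; proj₂)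
open import Data.Vec.Base using ([]; _∷_; tabulate)
open import Function.Base using (id)
open import Relation.Binary.Core using (Rel)
open import Relation.Binary.Definitions using (Symmetric; Irreflexive) renaming (Decidable to Decidable₂)
open import Relation.Binary.PropositionalEquality
  using (_≡_; _≢_; refl; sym; ≢-sym; trans; cong; subst)
open import Relation.Nullary.Decidable using (yes; no; ⌊_⌋; ¬?; _×-dec_; _→-dec_)
open import Relation.Nullary.Negation using (¬_)
open import Relation.Unary using (Pred; Decidable)
open import Level using (0ℓ)

-- The vertex set is an arbitrary subset of the ambient finite set Fin N,
-- so deleting vertices requires no relabelling.
record Graph (N : ℕ) : Set₁ where
  field
    V      : Subset N
    _~_    : Rel (Fin N) 0ℓ
    _~?_   : Decidable₂ _~_
    ~-sym  : Symmetric _~_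
    ~-irr  : Irreflexive _≡_ _~_
    ~⇒∈V   : ∀ {u v} → u ~ v → u ∈ V

  neighbours : Fin N → Subset N
  neighbours v = tabulate λ u → ⌊ v ~? u ⌋

  deg : Fin N → ℕ
  deg v = ∣ neighbours v ∣

open Graph using (V)

_-ᴳ_ : ∀ {N} → Graph N → Subset N → Graph N
G -ᴳ S = record
  { V     = G.V ─ S
  ; _~_   = λ u v → u G.~ v × u ∈ G.V ─ S × v ∈ G.V ─ S
  ; _~?_  = λ u v → (u G.~? v) ×-dec (u ∈? (G.V ─ S)) ×-dec (v ∈? (G.V ─ S))
  ; ~-sym = λ (e , u∈ , v∈) → G.~-sym e , v∈ , u∈
  ; ~-irr = λ eq (e , _) → G.~-irr eq e
  ; ~⇒∈V  = λ (_ , u∈ , _) → u∈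
  }
  where module G = Graph G

-- minSize is the least cardinality of a subset satisfying P; by minSize-attained
-- and minSize-≤ it does not depend on the witness supplied for existence.
module _ {N : ℕ} {P : Pred (Subset N) 0ℓ} (P? : Decidable P) where

  private
    descend : ∀ S → P S → Acc _<_ ∣ S ∣ →
              ∃[ T ] P T × (∀ U → P U → ∣ T ∣ ≤ ∣ U ∣)
    descend S pS (acc rec)
      with anySubset? (λ T → P? T ×-dec (∣ T ∣ <? ∣ S ∣))
    ... | yes (T , pT , T<S) = descend T pT (rec T<S)
    ... | no ¬smaller = S , pS , λ U pU → ≮⇒≥ λ U<S → ¬smaller (U , pU , U<S)

    smallest : ∃ P → ∃[ T ] P T × (∀ U → P U → ∣ T ∣ ≤ ∣ U ∣)
    smallest (S , pS) = descend S pS (<-wellFounded ∣ S ∣)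

  minSize : ∃ P → ℕ
  minSize e = ∣ proj₁ (smallest e) ∣

  minSize-attained : ∀ e → ∃[ S ] P S × ∣ S ∣ ≡ minSize e
  minSize-attained e = proj₁ (smallest e) , proj₁ (proj₂ (smallest e)) , refl

  minSize-≤ : ∀ e S → P S → minSize e ≤ ∣ S ∣
  minSize-≤ e = proj₂ (proj₂ (smallest e))

private
  p─p≡⊥ : ∀ {n} (p : Subset n) → p ─ p ≡ ⊥
  p─p≡⊥ []            = refl
  p─p≡⊥ (inside  ∷ p) = cong (outside ∷_) (p─p≡⊥ p)
  p─p≡⊥ (outside ∷ p) = cong (outside ∷_) (p─p≡⊥ p)

  x∈p⇒0<∣p∣ : ∀ {n} {x : Fin n} {p} → x ∈ p → 0 < ∣ p ∣
  x∈p⇒0<∣p∣ {x = x} {p} x∈p = subst (_≤ ∣ p ∣) (∣⁅x⁆∣≡1 x)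
    (p⊆q⇒∣p∣≤∣q∣ λ y∈⁅x⁆ → subst (_∈ p) (sym (x∈⁅y⁆⇒x≡y x y∈⁅x⁆)) x∈p)

module _ {N : ℕ} (G : Graph N) where
  open Graph G using (_~_; _~?_; deg)

  StrongDominating : Pred (Subset N) 0ℓ
  StrongDominating D =
    D ⊆ V G × (∀ v → v ∈ V G → v ∉ D → ∃[ u ] u ∈ D × v ~ u × deg v ≤ deg u)

  strongDominating? : Decidable StrongDominating
  strongDominating? D = (D ⊆? V G) ×-dec all? λ v →
    (v ∈? V G) →-dec ¬? (v ∈? D) →-dec
    any? λ u → (u ∈? D) ×-dec (v ~? u) ×-dec (deg v ≤? deg u)

  V-strongDominating : StrongDominating (V G)
  V-strongDominating = id , λ v v∈V v∉V → ⊥-elim (v∉V v∈V)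

  γst : ℕ
  γst = minSize strongDominating? (V G , V-strongDominating)

module _ {N : ℕ} (G : Graph N) where

  ChangesγstOf : Pred (Subset N) 0ℓ
  ChangesγstOf S = S ⊆ V G × γst (G -ᴳ S) ≢ γst G

  changesγstOf? : Decidable ChangesγstOf
  changesγstOf? S = (S ⊆? V G) ×-dec ¬? (γst (G -ᴳ S) ≟ℕ γst G)

  private
    γst≡0⇒empty : ∀ {M} (H : Graph M) → γst H ≡ 0 → ¬ Nonempty (V H)
    γst≡0⇒empty H γ≡0 (v , v∈V)
      with minSize-attained (strongDominating? H) (V H , V-strongDominating H)
    ... | D , (_ , dom) , ∣D∣≡γ = D-empty u∈D
      where
      D-empty : ∀ {x} → x ∉ D
      D-empty x∈D = n≮0 (subst (0 <_) (trans ∣D∣≡γ γ≡0) (x∈p⇒0<∣p∣ x∈D))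
      u∈D : proj₁ (dom v v∈V D-empty) ∈ D
      u∈D = proj₁ (proj₂ (dom v v∈V D-empty))

    γst-deleteAll : γst (G -ᴳ V G) ≡ 0
    γst-deleteAll = n≤0⇒n≡0 (subst (γst G′ ≤_) (trans (cong ∣_∣ V′≡⊥) (∣⊥∣≡0 N))
      (minSize-≤ (strongDominating? G′) (V G′ , V-strongDominating G′)
                 (V G′) (V-strongDominating G′)))
      where
      G′ : Graph N
      G′ = G -ᴳ V G
      V′≡⊥ : V G′ ≡ ⊥
      V′≡⊥ = p─p≡⊥ (V G)

  deleteAll-changes : Nonempty (V G) → ChangesγstOf (V G)
  deleteAll-changes ne =
    id , λ eq → γst≡0⇒empty G (trans (sym eq) γst-deleteAll) ne

  -- The null graph has no vertex set whose deletion changes γst, so the minimum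
  -- defining the stability only exists when there is at least one vertex.
  stγst : Nonempty (V G) → ℕ
  stγst ne = minSize changesγstOf? (V G , deleteAll-changes ne)

-- The parts are the fibres of quotient 2 : Fin (n * 2) → Fin n, i.e. {2i, 2i+1}.
CP : ∀ n → Graph (n * 2)
CP n = record
  { V     = ⊤
  ; _~_   = λ u v → part u ≢ part v
  ; _~?_  = λ u v → ¬? (part u ≟ part v)
  ; ~-sym = ≢-sym
  ; ~-irr = λ u≡v p≢ → p≢ (cong part u≡v)
  ; ~⇒∈V  = λ _ → ∈⊤
  }
  where
  part : Fin (n * 2) → Fin n
  part = quotient 2

CP-nonempty : ∀ {m n} → m < n → Nonempty (V (CP n))
CP-nonempty (s≤s _) = zero , ∈⊤

{-# OPTIONS --safe #-}
-- CP n has γst ≥ 2: a vertex never dominates the other vertex of its part, so a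
-- dominating set contains two vertices. After deleting one vertex, the other
-- vertex of its part is adjacent to all that remain, hence has maximum degree
-- and dominates strongly on its own. So one deletion changes γst, whereas
-- deleting nothing does not.
module Submission where

open import Defs
open import Data.Fin.Base using (Fin; zero; suc; quotient; remainder; combine; opposite)
open import Data.Fin.Properties using (remQuot-combine)
open import Data.Fin.Subset using (Subset; _∈_; _∉_; _⊆_; _-_; ∣_∣; ⊥; ⁅_⁆; Nonempty; inside; outside)
open import Data.Fin.Subset.Properties
  using (_∈?_; ∈⊤; p─⊥≡p; p─q⊆p; ∣⁅x⁆∣≡1; x∈⁅x⁆; x∈⁅y⁆⇒x≡y; p⊂q⇒∣p∣<∣q∣; p⊆q⇒∣p∣≤∣q∣;
         x∈p∧x≢y⇒x∈p-y; x∈p⇒∣p-x∣<∣p∣)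
open import Data.Nat.Base using (ℕ; zero; suc; _*_; _≤_; _<_; _≥_; z≤n; s≤s; s≤s⁻¹)
open import Data.Nat.Properties using (≤-trans; ≤-reflexive; ≤-antisym; ≤-<-trans; <⇒≢; n≢0⇒n>0; n≤1+n)
open import Data.Product.Base using (∃-syntax; _×_; _,_; proj₁; proj₂)
open import Data.Vec.Base using ([]; _∷_; here; there)
open import Data.Vec.Properties using (lookup∘tabulate; tabulate-cong; []=⇒lookup; lookup⇒[]=)
open import Function.Base using (_∘_)
open import Function.Bundles using (mk⇔)
open import Level using (0ℓ)
open import Relation.Binary.PropositionalEquality using (_≡_; _≢_; refl; sym; trans; cong; subst; subst₂)
open import Relation.Nullary.Decidable using (yes; no; isYes≗does; does-⇔; dec-true)
open import Relation.Nullary.Negation using (contradiction)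
open import Relation.Unary using (Pred; Decidable) renaming (_⊆_ to _⊆ᴾ_)

open Graph using (V; neighbours; deg)

∣p∣≡0⇒p≡⊥ : ∀ {n} (p : Subset n) → ∣ p ∣ ≡ 0 → p ≡ ⊥
∣p∣≡0⇒p≡⊥ []            _  = refl
∣p∣≡0⇒p≡⊥ (outside ∷ p) eq = cong (outside ∷_) (∣p∣≡0⇒p≡⊥ p eq)

∣p∣≤1+∣p-x∣ : ∀ {n} (p : Subset n) x → ∣ p ∣ ≤ suc ∣ p - x ∣
∣p∣≤1+∣p-x∣ (inside  ∷ p) zero    = s≤s (≤-reflexive (cong ∣_∣ (sym (p─⊥≡p p))))
∣p∣≤1+∣p-x∣ (outside ∷ p) zero    = ≤-trans (≤-reflexive (cong ∣_∣ (sym (p─⊥≡p p)))) (n≤1+n _)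
∣p∣≤1+∣p-x∣ (inside  ∷ p) (suc x) = s≤s (∣p∣≤1+∣p-x∣ p x)
∣p∣≤1+∣p-x∣ (outside ∷ p) (suc x) = ∣p∣≤1+∣p-x∣ p x

x∉p-x : ∀ {n} (p : Subset n) x → x ∉ p - x
x∉p-x (_ ∷ p) (suc x) (there x∈) = x∉p-x p x x∈

-- The cardinality drops strictly twice along `p`, `p - y`, `p - y - x`.
x,y∈p∧x≢y⇒2≤∣p∣ : ∀ {n} {p : Subset n} {x y} → x ∈ p → y ∈ p → x ≢ y → 2 ≤ ∣ p ∣
x,y∈p∧x≢y⇒2≤∣p∣ x∈p y∈p x≢y =
  ≤-<-trans (≤-<-trans z≤n (x∈p⇒∣p-x∣<∣p∣ (x∈p∧x≢y⇒x∈p-y x∈p x≢y))) (x∈p⇒∣p-x∣<∣p∣ y∈p)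

minSize-anti : ∀ {N} {P Q : Pred (Subset N) 0ℓ} (P? : Decidable P) (Q? : Decidable Q) p q →
               P ⊆ᴾ Q → minSize Q? q ≤ minSize P? p
minSize-anti P? Q? p q P⊆Q =
  let S , pS , ∣S∣≡ = minSize-attained P? p
  in subst (minSize Q? q ≤_) ∣S∣≡ (minSize-≤ Q? q S (P⊆Q pS))

module _ {N} (G : Graph N) where
  open Graph G using (_~_; _~?_; ~-sym; ~-irr; ~⇒∈V)

  ~⇒∈neighbours : ∀ {v u} → v ~ u → u ∈ neighbours G v
  ~⇒∈neighbours {v} {u} v~u = lookup⇒[]= u _
    (trans (lookup∘tabulate _ u) (trans (isYes≗does (v ~? u)) (dec-true (v ~? u) v~u)))

  ∈neighbours⇒~ : ∀ {v u} → u ∈ neighbours G v → v ~ u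
  -- Abstracting `v ~? u` in the lookup equation as well turns that equation into `false ≡ true` in
  -- the `no` case.
  ∈neighbours⇒~ {v} {u} u∈ with v ~? u | trans (sym (lookup∘tabulate _ u)) ([]=⇒lookup u∈)
  ... | yes v~u | _  = v~u
  ... | no  _   | ()

  -- By irreflexivity, `v` itself witnesses that its neighbourhood is a proper subset of `V G`.
  deg<∣V∣ : ∀ {v} → v ∈ V G → deg G v < ∣ V G ∣
  deg<∣V∣ {v} v∈V = p⊂q⇒∣p∣<∣q∣
    ( ~⇒∈V ∘ ~-sym ∘ ∈neighbours⇒~
    , v , v∈V , ~-irr refl ∘ ∈neighbours⇒~)

  ⁅x⁆⊆V : ∀ {x} → x ∈ V G → ⁅ x ⁆ ⊆ V G
  ⁅x⁆⊆V {x} x∈V y∈ = subst (_∈ V G) (sym (x∈⁅y⁆⇒x≡y x y∈)) x∈V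

  universal⇒γst≤1 : ∀ {u} → u ∈ V G → (∀ {v} → v ∈ V G → v ≢ u → v ~ u) → γst G ≤ 1
  universal⇒γst≤1 {u} u∈V univ = subst (γst G ≤_) (∣⁅x⁆∣≡1 u)
    (minSize-≤ (strongDominating? G) (V G , V-strongDominating G) ⁅ u ⁆ (⁅x⁆⊆V u∈V , dominates))
    where
    V-u⊆neighbours : V G - u ⊆ neighbours G u
    V-u⊆neighbours x∈ = ~⇒∈neighbours (~-sym (univ (p─q⊆p _ _ x∈) λ { refl → x∉p-x (V G) u x∈ }))

    dominates : ∀ v → v ∈ V G → v ∉ ⁅ u ⁆ → ∃[ w ] w ∈ ⁅ u ⁆ × v ~ w × deg G v ≤ deg G w
    dominates v v∈V v∉⁅u⁆ =
      u , x∈⁅x⁆ u , univ v∈V (λ { refl → v∉⁅u⁆ (x∈⁅x⁆ u) }) ,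
      -- `1 + deg v ≤ ∣V∣ ≤ 1 + ∣V - u∣ ≤ 1 + deg
      -- u`, since every vertex other than `u` is a neighbour of `u`.
      s≤s⁻¹ (≤-trans (deg<∣V∣ v∈V)
        (≤-trans (∣p∣≤1+∣p-x∣ (V G) u) (s≤s (p⊆q⇒∣p∣≤∣q∣ V-u⊆neighbours))))

  ∈V⇒∈V-⊥ : ∀ {x} → x ∈ V G → x ∈ V (G -ᴳ ⊥)
  ∈V⇒∈V-⊥ = subst (_ ∈_) (sym (p─⊥≡p (V G)))

  ∈V-⊥⇒∈V : ∀ {x} → x ∈ V (G -ᴳ ⊥) → x ∈ V G
  ∈V-⊥⇒∈V = subst (_ ∈_) (p─⊥≡p (V G))

  -- Adjacency in `G -ᴳ ⊥` carries two membership proofs, so it is only logically equivalent to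
  -- adjacency in `G`. Equivalent propositions have equal decisions, hence both neighbourhoods
  -- tabulate the same booleans.
  deg-⊥ : ∀ v → deg (G -ᴳ ⊥) v ≡ deg G v
  deg-⊥ v = cong ∣_∣ (tabulate-cong λ u →
    trans (isYes≗does (Graph._~?_ (G -ᴳ ⊥) v u)) (trans
      (does-⇔ (mk⇔ proj₁ (λ v~u → v~u , ∈V⇒∈V-⊥ (~⇒∈V v~u) , ∈V⇒∈V-⊥ (~⇒∈V (~-sym v~u))))
             (Graph._~?_ (G -ᴳ ⊥) v u) (v ~? u))
      (sym (isYes≗does (v ~? u)))))

  -- Both graphs have the same strong dominating sets; each inclusion gives one inequality between
  -- the minima.
  γst-⊥ : γst (G -ᴳ ⊥) ≡ γst G
  γst-⊥ = ≤-antisym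
    (minSize-anti (strongDominating? G) (strongDominating? (G -ᴳ ⊥))
      (V G , V-strongDominating G) (V (G -ᴳ ⊥) , V-strongDominating (G -ᴳ ⊥)) λ (D⊆V , dom) →
      ∈V⇒∈V-⊥ ∘ D⊆V , λ v v∈ v∉D → let u , u∈D , v~u , le = dom v (∈V-⊥⇒∈V v∈) v∉D in
        u , u∈D , (v~u , v∈ , ∈V⇒∈V-⊥ (D⊆V u∈D)) ,
        subst₂ _≤_ (sym (deg-⊥ v)) (sym (deg-⊥ u)) le)
    (minSize-anti (strongDominating? (G -ᴳ ⊥)) (strongDominating? G)
      (V (G -ᴳ ⊥) , V-strongDominating (G -ᴳ ⊥)) (V G , V-strongDominating G) λ (D⊆V , dom) →
      ∈V-⊥⇒∈V ∘ D⊆V , λ v v∈ v∉D → let u , u∈D , (v~u , _) , le = dom v (∈V⇒∈V-⊥ v∈) v∉D in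
        u , u∈D , v~u , subst₂ _≤_ (deg-⊥ v) (deg-⊥ u) le)

  -- A minimiser of size 0 would be `⊥`, whose deletion leaves `γst` unchanged.
  1≤stγst : ∀ ne → 1 ≤ stγst G ne
  1≤stγst ne = n≢0⇒n>0 λ st≡0 →
    let S , (_ , γ≢) , ∣S∣≡ = minSize-attained (changesγstOf? G) (V G , deleteAll-changes G ne)
    in γ≢ (trans (cong (γst ∘ (G -ᴳ_)) (∣p∣≡0⇒p≡⊥ S (trans ∣S∣≡ st≡0))) γst-⊥)

  stγst≡1 : ∀ ne {v} → v ∈ V G → γst (G -ᴳ ⁅ v ⁆) < γst G → stγst G ne ≡ 1
  stγst≡1 ne {v} v∈V γ< = ≤-antisym
    (subst (stγst G ne ≤_) (∣⁅x⁆∣≡1 v)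
      (minSize-≤ (changesγstOf? G) (V G , deleteAll-changes G ne) ⁅ v ⁆ (⁅x⁆⊆V v∈V , <⇒≢ γ<)))
    (1≤stγst ne)

module _ {n : ℕ} where

  -- On `Fin 2`, `opposite` swaps the two positions, so this is the other vertex of the part of `u`.
  mate : Fin (n * 2) → Fin (n * 2)
  mate u = combine (quotient {n} 2 u) (opposite (remainder {n} 2 u))

  quotient-mate : ∀ u → quotient {n} 2 (mate u) ≡ quotient {n} 2 u
  quotient-mate u = cong proj₁ (remQuot-combine {n} (quotient {n} 2 u) _)

  mate≢ : ∀ u → mate u ≢ u
  mate≢ u eq = opposite≢ _ (trans (sym (cong proj₂ (remQuot-combine {n} (quotient {n} 2 u) _)))
                                  (cong (remainder {n} 2) eq))
    where
    opposite≢ : (i : Fin 2) → opposite i ≢ i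
    opposite≢ zero       ()
    opposite≢ (suc zero) ()

2≤∣strongDominating-CP∣ : ∀ {n D} → Nonempty (V (CP n)) → StrongDominating (CP n) D → 2 ≤ ∣ D ∣
2≤∣strongDominating-CP∣ {n} {D} (x , _) (_ , dom) = 2≤∣D∣ D-nonempty
  where
  D-nonempty : Nonempty D
  D-nonempty with x ∈? D
  ... | yes x∈D = x , x∈D
  ... | no  x∉D = let u , u∈D , _ = dom x ∈⊤ x∉D in u , u∈D

  2≤∣D∣ : Nonempty D → 2 ≤ ∣ D ∣
  2≤∣D∣ (u , u∈D) with mate {n} u ∈? D
  ... | yes u′∈D = x,y∈p∧x≢y⇒2≤∣p∣ u′∈D u∈D (mate≢ {n} u)
  ... | no  u′∉D = let w , w∈D , u′~w , _ = dom (mate {n} u) ∈⊤ u′∉D in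
    -- `w` lies outside the part of `mate u`, which is also the part of `u`.
    x,y∈p∧x≢y⇒2≤∣p∣ u∈D w∈D λ u≡w →
      u′~w (trans (quotient-mate {n} u) (cong (quotient {n} 2) u≡w))

2≤γst-CP : ∀ n → Nonempty (V (CP n)) → 2 ≤ γst (CP n)
2≤γst-CP n ne =
  let D , dom , ∣D∣≡ = minSize-attained (strongDominating? (CP n)) (V (CP n) , V-strongDominating (CP n))
  in subst (2 ≤_) ∣D∣≡ (2≤∣strongDominating-CP∣ {n} ne dom)

γst-CP-⁅0⁆≤1 : ∀ m → γst (CP (suc m) -ᴳ ⁅ zero ⁆) ≤ 1
γst-CP-⁅0⁆≤1 m = universal⇒γst≤1 G′ {suc zero} 1∈V′ universal
  where
  G′ = CP (suc m) -ᴳ ⁅ zero ⁆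
  1∈V′ : suc zero ∈ V G′
  1∈V′ = there here
  adjacent : ∀ {v} → v ∈ V G′ → v ≢ suc zero → quotient {suc m} 2 v ≢ quotient {suc m} 2 (suc zero)
  -- Vertices 0 and 1 form the first part. Vertex 0 is deleted, and from 2 on `quotient` computes to
  -- a successor, which differs from the part `zero` of vertex 1.
  adjacent {zero}        ()
  adjacent {suc zero}    _ v≢1 = contradiction refl v≢1
  adjacent {suc (suc _)} _ _   ()
  universal : ∀ {v} → v ∈ V G′ → v ≢ suc zero → Graph._~_ G′ v (suc zero)
  universal v∈ v≢1 = adjacent v∈ v≢1 , v∈ , 1∈V′

proposition2p9 : ∀ (n : ℕ) (n≥3 : n ≥ 3) → stγst (CP n) (CP-nonempty n≥3) ≡ 1
proposition2p9 n@(suc m) n≥3 = stγst≡1 (CP n) (CP-nonempty n≥3) {zero} ∈⊤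
  -- The strict decrease: one plus the new value is at most 2, and 2 is at most the old value.
  (≤-trans (s≤s (γst-CP-⁅0⁆≤1 m)) (2≤γst-CP n (CP-nonempty n≥3)))
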